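{- Let $(T,\cdot,e)$ and $(U,\cdot,e)$ be monoids, let $M$ be a $T$-graded monad and $P$ a $U$-graded monad on a category $\mathbf{C}$, and let $\lambda^{u,t}\colon P_uM_t\to M_tP_u$ ($u\in U$, $t\in T$) be a graded distributive law of $P$ over $M$. Then $\lambda$ induces a composite $(T\times U)$-graded monad with underlying functors $M_tP_u$: the family of endofunctors $(M_tP_u)_{(t,u)\in T\times U}$, together with the unit and multiplications induced by $\lambda$, is a $(T\times U)$-graded monad on $\mathbf{C}$.
   Context: A monad $M$ graded by a monoid $(T,\cdot,e)$ on a category $\mathbf{C}$ consists of endofunctors $M_t\colon\mathbf{C}\to\mathbf{C}$ ($t\in T$), natural transformations $\mu^{s,t}\colon M_sM_t\to M_{s\cdot t}$ ($s,t\in T$) and a natural transformation $\eta\colon \mathrm{Id}\to M_e$ such that $\mu^{r,s\cdot t}\circ M_r\mu^{s,t}=\mu^{r\cdot s,t}\circ\mu^{r,s}M_t$ and $\mu^{t,e}\circ M_t\eta=\mathrm{id}=\mu^{e,t}\circ\eta M_t$ for all $r,s,t\in T$. A graded distributive law of a $U$-graded monad $P$ over a $T$-graded monad $M$ is a family of natural transformations $\lambda^{u,t}\colon P_uM_t\to M_tP_u$ such that, for all $s,t\in T$, $u,v\in U$: (1) $\lambda^{u,s\cdot t}\circ P_u\mu^{s,t}=\mu^{s,t}P_u\circ M_s\lambda^{u,t}\circ\lambda^{u,s}M_t$; (2) $\lambda^{u\cdot v,t}\circ\mu^{u,v}M_t=M_t\mu^{u,v}\circ\lambda^{u,t}P_v\circ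 P_u\lambda^{v,t}$; (3) $\lambda^{u,e}\circ P_u\eta=\eta P_u$; (4) $\lambda^{e,t}\circ\eta M_t=M_t\eta$. The unit and multiplications induced by $\lambda$ are the horizontal composite of the two units, $\mathrm{Id}\to M_eP_e$, and the composites $M_sP_uM_tP_v\xrightarrow{M_s\lambda^{u,t}P_v}M_sM_tP_uP_v\to M_{s\cdot t}P_{u\cdot v}$, where the last arrow is the horizontal composite of $\mu^{s,t}$ (of $M$) and $\mu^{u,v}$ (of $P$). The product monoid $T\times U$ has componentwise operations. -}

module Defs where

open import Level using (Level; _⊔_; suc)
open import Data.Product using (_×_; _,_; proj₁; proj₂)
open import Relation.Binary.Core using (Rel)
open import Relation.Binary.Structures using (IsEquivalence)
open import Relation.Binary.PropositionalEquality using (_≡_; refl; cong₂; subst; isEquivalence)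
open import Algebra.Structures using (IsMonoid)

private
  variable
    o ℓ e a b : Level

-- The equality of a grading monoid is _≡_ rather than that of a setoid: the
-- functors M_{(r·s)·t} and M_{r·(s·t)} are to be literally the same, and the
-- laws of a graded monad are compared along this identification.

record GradingMonoid (a : Level) : Set (suc a) where
  infixl 7 _∙_
  field
    Carrier  : Set a
    _∙_      : Carrier → Carrier → Carrier
    ε        : Carrier
    isMonoid : IsMonoid _≡_ _∙_ ε

  open IsMonoid isMonoid public using (assoc; identityˡ; identityʳ)

_×ᴹ_ : GradingMonoid a → GradingMonoid b → GradingMonoid (a ⊔ b)
T ×ᴹ U = record
  { Carrier  = T.Carrier × U.Carrier
  ; _∙_      = λ x y → proj₁ x T.∙ proj₁ y , proj₂ x U.∙ proj₂ y
  ; ε        = T.ε , U.ε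
  ; isMonoid = record
    { isSemigroup = record
      { isMagma = record
        { isEquivalence = isEquivalence
        ; ∙-cong        = cong₂ _
        }
      ; assoc = λ x y z → cong₂ _,_ (T.assoc (proj₁ x) (proj₁ y) (proj₁ z))
                                    (U.assoc (proj₂ x) (proj₂ y) (proj₂ z))
      }
    ; identity = (λ x → cong₂ _,_ (T.identityˡ (proj₁ x)) (U.identityˡ (proj₂ x)))
               , (λ x → cong₂ _,_ (T.identityʳ (proj₁ x)) (U.identityʳ (proj₂ x)))
    }
  }
  where
    module T = GradingMonoid T
    module U = GradingMonoid U

-- Hom-sets are setoids: _≈_ is equality of morphisms.

record Category (o ℓ e : Level) : Set (suc (o ⊔ ℓ ⊔ e)) where
  infix  4 _≈_ _⇒_
  infixr 9 _∘_
  field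
    Obj       : Set o
    _⇒_       : Rel Obj ℓ
    _≈_       : ∀ {A B} → Rel (A ⇒ B) e
    id        : ∀ {A} → A ⇒ A
    _∘_       : ∀ {A B C} → B ⇒ C → A ⇒ B → A ⇒ C
    equiv     : ∀ {A B} → IsEquivalence (_≈_ {A} {B})
    ∘-cong    : ∀ {A B C} {f h : B ⇒ C} {g i : A ⇒ B} → f ≈ h → g ≈ i → f ∘ g ≈ h ∘ i
    assoc     : ∀ {A B C D} {f : A ⇒ B} {g : B ⇒ C} {h : C ⇒ D} → (h ∘ g) ∘ f ≈ h ∘ (g ∘ f)
    identityˡ : ∀ {A B} {f : A ⇒ B} → id ∘ f ≈ f
    identityʳ : ∀ {A B} {f : A ⇒ B} → f ∘ id ≈ f

  module Equiv {A B : Obj} = IsEquivalence (equiv {A} {B})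

  glue : ∀ {A B C A′ B′ C′} {f : A ⇒ B} {g : B ⇒ C} {f′ : A′ ⇒ B′} {g′ : B′ ⇒ C′}
           {x : A ⇒ A′} {y : B ⇒ B′} {z : C ⇒ C′} →
         g′ ∘ y ≈ z ∘ g → f′ ∘ x ≈ y ∘ f → (g′ ∘ f′) ∘ x ≈ z ∘ (g ∘ f)
  glue q p =
    Equiv.trans assoc
      (Equiv.trans (∘-cong Equiv.refl p)
        (Equiv.trans (Equiv.sym assoc)
          (Equiv.trans (∘-cong q Equiv.refl) assoc)))

module _ (C : Category o ℓ e) where
  open Category C

  record Endofunctor : Set (o ⊔ ℓ ⊔ e) where
    field
      F₀           : Obj → Obj
      F₁           : ∀ {A B} → A ⇒ B → F₀ A ⇒ F₀ B
      identity     : ∀ {A} → F₁ (id {A}) ≈ id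
      homomorphism : ∀ {X Y Z} {f : X ⇒ Y} {g : Y ⇒ Z} → F₁ (g ∘ f) ≈ F₁ g ∘ F₁ f
      F-resp-≈     : ∀ {A B} {f g : A ⇒ B} → f ≈ g → F₁ f ≈ F₁ g

module _ {C : Category o ℓ e} where
  open Category C
  open Endofunctor

  infixr 9 _∘F_
  infix  4 _⟹_
  infixr 8 _∗_
  infixr 8 _▹_
  infixl 8 _◃_

  Id : Endofunctor C
  Id = record
    { F₀           = λ A → A
    ; F₁           = λ f → f
    ; identity     = Equiv.refl
    ; homomorphism = Equiv.refl
    ; F-resp-≈     = λ p → p
    }

  _∘F_ : Endofunctor C → Endofunctor C → Endofunctor C
  G ∘F F = record
    { F₀           = λ A → F₀ G (F₀ F A)
    ; F₁           = λ f → F₁ G (F₁ F f)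
    ; identity     = Equiv.trans (F-resp-≈ G (identity F)) (identity G)
    ; homomorphism = Equiv.trans (F-resp-≈ G (homomorphism F)) (homomorphism G)
    ; F-resp-≈     = λ p → F-resp-≈ G (F-resp-≈ F p)
    }

  record _⟹_ (F G : Endofunctor C) : Set (o ⊔ ℓ ⊔ e) where
    field
      η       : ∀ X → F₀ F X ⇒ F₀ G X
      natural : ∀ {X Y} (f : X ⇒ Y) → η Y ∘ F₁ F f ≈ F₁ G f ∘ η X

  open _⟹_

  _∗_ : {F G H K : Endofunctor C} → H ⟹ K → F ⟹ G → (H ∘F F) ⟹ (K ∘F G)
  _∗_ {F} {G} {H} {K} β α = record
    { η       = λ X → F₁ K (η α X) ∘ η β (F₀ F X)
    ; natural = λ f → glue
        (Equiv.trans (Equiv.sym (homomorphism K))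
          (Equiv.trans (F-resp-≈ K (natural α f)) (homomorphism K)))
        (natural β (F₁ F f))
    }

  _▹_ : {F G : Endofunctor C} (H : Endofunctor C) → F ⟹ G → (H ∘F F) ⟹ (H ∘F G)
  H ▹ α = record
    { η       = λ X → F₁ H (η α X)
    ; natural = λ f → Equiv.trans (Equiv.sym (homomorphism H))
        (Equiv.trans (F-resp-≈ H (natural α f)) (homomorphism H))
    }

  _◃_ : {F G : Endofunctor C} → F ⟹ G → (H : Endofunctor C) → (F ∘F H) ⟹ (G ∘F H)
  α ◃ H = record
    { η       = λ X → η α (F₀ H X)
    ; natural = λ f → natural α (F₁ H f)
    }

module _ {C : Category o ℓ e} (T : GradingMonoid a) where
  open Category C using (Obj; _⇒_; _≈_; _∘_; id)
  open Endofunctor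
  open _⟹_
  open GradingMonoid T

  -- Equalities of natural transformations are stated componentwise.  For
  -- propositionally equal grades s and t, regrade identifies the hom-sets
  -- A ⇒ M_s X and A ⇒ M_t X; the paths used below do not matter, since K
  -- makes every proof of s ≡ t equal.

  regrade : (M : Carrier → Endofunctor C) {A X : Obj} {s t : Carrier} →
            s ≡ t → A ⇒ F₀ (M s) X → A ⇒ F₀ (M t) X
  regrade M {A} {X} = subst (λ r → A ⇒ F₀ (M r) X)

  record IsGradedMonad (M    : Carrier → Endofunctor C)
                       (unit : Id ⟹ M ε)
                       (mult : ∀ s t → M s ∘F M t ⟹ M (s ∙ t))
                       : Set (o ⊔ ℓ ⊔ e ⊔ a) where
    field
      mult-assoc : ∀ r s t X →
        η (mult r (s ∙ t)) X ∘ F₁ (M r) (η (mult s t) X)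
          ≈ regrade M (assoc r s t) (η (mult (r ∙ s) t) X ∘ η (mult r s) (F₀ (M t) X))
      mult-unitʳ : ∀ t X →
        regrade M (identityʳ t) (η (mult t ε) X ∘ F₁ (M t) (η unit X)) ≈ id
      mult-unitˡ : ∀ t X →
        regrade M (identityˡ t) (η (mult ε t) X ∘ η unit (F₀ (M t) X)) ≈ id

record GradedMonad (C : Category o ℓ e) (T : GradingMonoid a) : Set (o ⊔ ℓ ⊔ e ⊔ a) where
  open GradingMonoid T
  field
    functor       : Carrier → Endofunctor C
    unit          : Id ⟹ functor ε
    mult          : ∀ s t → functor s ∘F functor t ⟹ functor (s ∙ t)
    isGradedMonad : IsGradedMonad T functor unit mult

  open IsGradedMonad isGradedMonad public

module _ {C : Category o ℓ e} {T : GradingMonoid a} {U : GradingMonoid b} where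
  open Category C using (_≈_; _∘_; glue)
  open Endofunctor
  open _⟹_
  private
    module T = GradingMonoid T
    module U = GradingMonoid U

  record GradedDistributiveLaw (P : GradedMonad C U) (M : GradedMonad C T)
                               : Set (o ⊔ ℓ ⊔ e ⊔ a ⊔ b) where
    private
      module M = GradedMonad M
      module P = GradedMonad P
    field
      dist : ∀ u t → P.functor u ∘F M.functor t ⟹ M.functor t ∘F P.functor u

      dist-multᴹ : ∀ u s t X →
        η (dist u (s T.∙ t)) X ∘ F₁ (P.functor u) (η (M.mult s t) X)
          ≈ η (M.mult s t) (F₀ (P.functor u) X)
              ∘ F₁ (M.functor s) (η (dist u t) X)
              ∘ η (dist u s) (F₀ (M.functor t) X)
      dist-multᴾ : ∀ u v t X →
        η (dist (u U.∙ v) t) X ∘ η (P.mult u v) (F₀ (M.functor t) X)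
          ≈ F₁ (M.functor t) (η (P.mult u v) X)
              ∘ η (dist u t) (F₀ (P.functor v) X)
              ∘ F₁ (P.functor u) (η (dist v t) X)
      dist-unitᴹ : ∀ u X →
        η (dist u T.ε) X ∘ F₁ (P.functor u) (η M.unit X) ≈ η M.unit (F₀ (P.functor u) X)
      dist-unitᴾ : ∀ t X →
        η (dist U.ε t) X ∘ η P.unit (F₀ (M.functor t) X) ≈ F₁ (M.functor t) (η P.unit X)

  module _ {P : GradedMonad C U} {M : GradedMonad C T} (law : GradedDistributiveLaw P M) where
    private
      module M = GradedMonad M
      module P = GradedMonad P
    open GradedDistributiveLaw law
    open GradingMonoid (T ×ᴹ U)

    compositeFunctor : Carrier → Endofunctor C
    compositeFunctor (t , u) = M.functor t ∘F P.functor u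

    -- Composition of functors is unital and associative only up to the proof
    -- fields of Endofunctor, so the two natural transformations below are
    -- assembled from components rather than composed directly.

    compositeUnit : Id ⟹ compositeFunctor ε
    compositeUnit = record { η = η α ; natural = natural α }
      where
        α : Id ∘F Id ⟹ M.functor T.ε ∘F P.functor U.ε
        α = M.unit ∗ P.unit

    compositeMult : ∀ x y → compositeFunctor x ∘F compositeFunctor y ⟹ compositeFunctor (x ∙ y)
    compositeMult (s , u) (t , v) = record
      { η       = λ X → η β X ∘ η α X
      ; natural = λ f → glue (natural β f) (natural α f)
      }
      where
        α : M.functor s ∘F ((P.functor u ∘F M.functor t) ∘F P.functor v)
              ⟹ M.functor s ∘F ((M.functor t ∘F P.functor u) ∘F P.functor v)
        α = M.functor s ▹ (dist u t ◃ P.functor v)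

        β : (M.functor s ∘F M.functor t) ∘F (P.functor u ∘F P.functor v)
              ⟹ M.functor (s T.∙ t) ∘F P.functor (u U.∙ v)
        β = M.mult s t ∗ P.mult u v

{-# OPTIONS --safe #-}
module Submission where

open import Defs
open import Level using (Level)
open import Data.Product using (_,_)
open import Relation.Binary.Bundles using (Setoid)
open import Relation.Binary.PropositionalEquality using (_≡_; refl; cong₂)
import Relation.Binary.Reasoning.Setoid as SetoidReasoning

-- Naturality and the distributive law bring each iterated multiplication of
-- M_t P_u to the normal form M(p) ∘ m ∘ d, where p and m are iterated
-- multiplications (or multiplication-unit composites) of P and M alone and d
-- only moves P's past M's.  Both sides of associativity have the same d, so
-- each law of the composite splits into the same law of M and of P.

private
  variable
    o ℓ e a b : Level

module CategoryReasoning (C : Category o ℓ e) where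
  open Category C

  homSetoid : ∀ {A B} → Setoid ℓ e
  homSetoid {A} {B} = record { Carrier = A ⇒ B ; _≈_ = _≈_ ; isEquivalence = equiv }

  module HomReasoning {A B : Obj} = SetoidReasoning (homSetoid {A} {B})

  ∘-congˡ : ∀ {X Y Z} {f g : X ⇒ Y} {h : Y ⇒ Z} → f ≈ g → h ∘ f ≈ h ∘ g
  ∘-congˡ = ∘-cong Equiv.refl

  ∘-congʳ : ∀ {X Y Z} {f : X ⇒ Y} {g h : Y ⇒ Z} → g ≈ h → g ∘ f ≈ h ∘ f
  ∘-congʳ p = ∘-cong p Equiv.refl

  pullˡ : ∀ {W X Y Z} {f : W ⇒ X} {g : X ⇒ Y} {h : Y ⇒ Z} {k : X ⇒ Z} →
          h ∘ g ≈ k → h ∘ g ∘ f ≈ k ∘ f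
  pullˡ p = Equiv.trans (Equiv.sym assoc) (∘-congʳ p)

  -- The calculations below keep long composites nested to the right; this applies a commuting
  -- square to the two leading factors of such a chain without further reassociation.
  extendʳ : ∀ {W X Y Y′ Z} {f : W ⇒ X} {g : X ⇒ Y} {h : Y ⇒ Z} {g′ : X ⇒ Y′} {h′ : Y′ ⇒ Z} →
            h ∘ g ≈ h′ ∘ g′ → h ∘ g ∘ f ≈ h′ ∘ g′ ∘ f
  extendʳ p = Equiv.trans (pullˡ p) assoc

module _ {C : Category o ℓ e} where
  open Category C
  open CategoryReasoning C
  open Endofunctor

  F-square : (F : Endofunctor C) {X Y Y′ Z : Obj}
             {g : X ⇒ Y} {h : Y ⇒ Z} {g′ : X ⇒ Y′} {h′ : Y′ ⇒ Z} →
             h ∘ g ≈ h′ ∘ g′ → F₁ F h ∘ F₁ F g ≈ F₁ F h′ ∘ F₁ F g′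
  F-square F p = Equiv.trans (Equiv.sym (homomorphism F)) (Equiv.trans (F-resp-≈ F p) (homomorphism F))

  F-triangle : (F : Endofunctor C) {X Y Z : Obj} {g : X ⇒ Y} {h : Y ⇒ Z} {k : X ⇒ Z} →
               h ∘ g ≈ k → F₁ F h ∘ F₁ F g ≈ F₁ F k
  F-triangle F p = Equiv.trans (Equiv.sym (homomorphism F)) (F-resp-≈ F p)

  -- Regrading changes only the codomain, so it ignores precomposition. This lets the associativity
  -- law of `M` be used in front of `distAll`.
  regrade-∘ : (T : GradingMonoid a) (M : GradingMonoid.Carrier T → Endofunctor C)
              {A B X : Obj} {s t : GradingMonoid.Carrier T} (p : s ≡ t)
              {f : A ⇒ B} {g : B ⇒ F₀ (M s) X} →
              regrade T M p (g ∘ f) ≈ regrade T M p g ∘ f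
  regrade-∘ T M refl = Equiv.refl

module Composite {C : Category o ℓ e} {T : GradingMonoid a} {U : GradingMonoid b}
                 {M : GradedMonad C T} {P : GradedMonad C U}
                 (law : GradedDistributiveLaw P M) where
  open Category C
  open CategoryReasoning C
  open Endofunctor
  open _⟹_ using (natural)
  open GradedDistributiveLaw law
  private
    module T = GradingMonoid T
    module U = GradingMonoid U
    module TU = GradingMonoid (T ×ᴹ U)
    module M = GradedMonad M
    module P = GradedMonad P

    M₀ : T.Carrier → Obj → Obj
    M₀ t = F₀ (M.functor t)

    P₀ : U.Carrier → Obj → Obj
    P₀ u = F₀ (P.functor u)

    M₁ : ∀ t {X Y} → X ⇒ Y → M₀ t X ⇒ M₀ t Y
    M₁ t = F₁ (M.functor t)

    P₁ : ∀ u {X Y} → X ⇒ Y → P₀ u X ⇒ P₀ u Y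
    P₁ u = F₁ (P.functor u)

    ηᴹ : ∀ X → X ⇒ M₀ T.ε X
    ηᴹ = _⟹_.η M.unit

    ηᴾ : ∀ X → X ⇒ P₀ U.ε X
    ηᴾ = _⟹_.η P.unit

    μᴹ : ∀ s t X → M₀ s (M₀ t X) ⇒ M₀ (s T.∙ t) X
    μᴹ s t = _⟹_.η (M.mult s t)

    μᴾ : ∀ u v X → P₀ u (P₀ v X) ⇒ P₀ (u U.∙ v) X
    μᴾ u v = _⟹_.η (P.mult u v)

    δ : ∀ u t X → P₀ u (M₀ t X) ⇒ M₀ t (P₀ u X)
    δ u t = _⟹_.η (dist u t)

    unit : ∀ X → X ⇒ M₀ T.ε (P₀ U.ε X)
    unit = _⟹_.η (compositeUnit law)

    mult : ∀ x y X → F₀ (compositeFunctor law x ∘F compositeFunctor law y) X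
                       ⇒ F₀ (compositeFunctor law (x TU.∙ y)) X
    mult x y = _⟹_.η (compositeMult law x y)

  -- The monoid laws of `T ×ᴹ U` are by definition `cong₂ _,_` of those of `T` and `U`, so regrading
  -- a normal form splits into one regrading for each factor. The paths are kept arbitrary so that
  -- both can be matched with `refl`, which is impossible for the monoid laws themselves.
  regrade-composite :
    {A B X : Obj} {s t : T.Carrier} {u v : U.Carrier} (p : s ≡ t) (q : u ≡ v)
    {f : A ⇒ M₀ s B} {g : B ⇒ P₀ u X} →
    regrade (T ×ᴹ U) (compositeFunctor law) (cong₂ _,_ p q) (M₁ s g ∘ f)
      ≈ M₁ t (regrade U P.functor q g) ∘ regrade T M.functor p f
  regrade-composite refl refl = Equiv.refl

  regrade-composite-cong :
    {A X : Obj} {x y : TU.Carrier} (p : x ≡ y)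
    {f g : A ⇒ F₀ (compositeFunctor law x) X} → f ≈ g →
    regrade (T ×ᴹ U) (compositeFunctor law) p f ≈ regrade (T ×ᴹ U) (compositeFunctor law) p g
  regrade-composite-cong refl f≈g = f≈g

  -- Both unit laws of the composite end this way: once `h` is in normal form, the unit law of `M`
  -- turns the regraded `f` into `id`, and that of `P` does so for `g`.
  regrade-composite-id :
    {X : Obj} {s t : T.Carrier} {u v : U.Carrier} (p : s ≡ t) (q : u ≡ v)
    {h : M₀ t (P₀ v X) ⇒ M₀ s (P₀ u X)} {f : M₀ t (P₀ v X) ⇒ M₀ s (P₀ v X)} {g : P₀ v X ⇒ P₀ u X} →
    h ≈ M₁ s g ∘ f → regrade T M.functor p f ≈ id → regrade U P.functor q g ≈ id →
    regrade (T ×ᴹ U) (compositeFunctor law) (cong₂ _,_ p q) h ≈ id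
  regrade-composite-id {t = t} p q {h} {f} {g} h≈ f≈id g≈id = begin
    regrade (T ×ᴹ U) (compositeFunctor law) (cong₂ _,_ p q) h
      ≈⟨ regrade-composite-cong (cong₂ _,_ p q) h≈ ⟩
    regrade (T ×ᴹ U) (compositeFunctor law) (cong₂ _,_ p q) (M₁ _ g ∘ f)
      ≈⟨ regrade-composite p q ⟩
    M₁ t (regrade U P.functor q g) ∘ regrade T M.functor p f
      ≈⟨ ∘-cong (Equiv.trans (F-resp-≈ (M.functor t) g≈id) (identity (M.functor t))) f≈id ⟩
    id ∘ id
      ≈⟨ identityˡ ⟩
    id ∎
    where open HomReasoning

  -- The unit of `P` slides out past `δ` by naturality, after which `dist-unitᴹ` absorbs `δ` into
  -- the unit of `M`. Naturality of `μᴹ` then gathers the `P` part on the left.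
  mult-unitʳ-normal : ∀ t u X →
    mult (t , u) TU.ε X ∘ M₁ t (P₁ u (unit X))
      ≈ M₁ (t T.∙ T.ε) (μᴾ u U.ε X ∘ P₁ u (ηᴾ X))
          ∘ μᴹ t T.ε (P₀ u X) ∘ M₁ t (ηᴹ (P₀ u X))
  mult-unitʳ-normal t u X = begin
    ((M₁ tε μ ∘ μᴹ t T.ε _) ∘ M₁ t (δ u T.ε _)) ∘ M₁ t (P₁ u (unit X))
      ≈⟨ Equiv.trans assoc assoc ⟩
    M₁ tε μ ∘ μᴹ t T.ε _ ∘ M₁ t (δ u T.ε _) ∘ M₁ t (P₁ u (unit X))
      ≈⟨ ∘-congˡ (∘-congˡ (F-square (M.functor t) dist-unit)) ⟩
    M₁ tε μ ∘ μᴹ t T.ε _ ∘ M₁ t (M₁ T.ε (P₁ u (ηᴾ X))) ∘ M₁ t (ηᴹ (P₀ u X))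
      ≈⟨ ∘-congˡ (extendʳ (natural (M.mult t T.ε) (P₁ u (ηᴾ X)))) ⟩
    M₁ tε μ ∘ M₁ tε (P₁ u (ηᴾ X)) ∘ μᴹ t T.ε _ ∘ M₁ t (ηᴹ (P₀ u X))
      ≈⟨ pullˡ (F-triangle (M.functor tε) Equiv.refl) ⟩
    M₁ tε (μ ∘ P₁ u (ηᴾ X)) ∘ μᴹ t T.ε _ ∘ M₁ t (ηᴹ (P₀ u X)) ∎
    where
      open HomReasoning
      tε = t T.∙ T.ε
      μ = μᴾ u U.ε X

      dist-unit : δ u T.ε _ ∘ P₁ u (unit X) ≈ M₁ T.ε (P₁ u (ηᴾ X)) ∘ ηᴹ (P₀ u X)
      dist-unit = begin
        δ u T.ε _ ∘ P₁ u (M₁ T.ε (ηᴾ X) ∘ ηᴹ X)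
          ≈⟨ ∘-congˡ (homomorphism (P.functor u)) ⟩
        δ u T.ε _ ∘ P₁ u (M₁ T.ε (ηᴾ X)) ∘ P₁ u (ηᴹ X)
          ≈⟨ extendʳ (natural (dist u T.ε) (ηᴾ X)) ⟩
        M₁ T.ε (P₁ u (ηᴾ X)) ∘ δ u T.ε X ∘ P₁ u (ηᴹ X)
          ≈⟨ ∘-congˡ (dist-unitᴹ u X) ⟩
        M₁ T.ε (P₁ u (ηᴾ X)) ∘ ηᴹ (P₀ u X) ∎

  -- Here `δ` meets the unit of `P` directly, so `dist-unitᴾ` removes it at once and only naturality
  -- of `μᴹ` remains to be used.
  mult-unitˡ-normal : ∀ t u X →
    mult TU.ε (t , u) X ∘ unit (M₀ t (P₀ u X))
      ≈ M₁ (T.ε T.∙ t) (μᴾ U.ε u X ∘ ηᴾ (P₀ u X))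
          ∘ μᴹ T.ε t (P₀ u X) ∘ ηᴹ (M₀ t (P₀ u X))
  mult-unitˡ-normal t u X = begin
    ((M₁ εt μ ∘ μᴹ T.ε t _) ∘ M₁ T.ε (δ U.ε t _)) ∘ M₁ T.ε (ηᴾ _) ∘ ηᴹ _
      ≈⟨ Equiv.trans assoc assoc ⟩
    M₁ εt μ ∘ μᴹ T.ε t _ ∘ M₁ T.ε (δ U.ε t _) ∘ M₁ T.ε (ηᴾ _) ∘ ηᴹ _
      ≈⟨ ∘-congˡ (∘-congˡ (pullˡ (F-triangle (M.functor T.ε) (dist-unitᴾ t _)))) ⟩
    M₁ εt μ ∘ μᴹ T.ε t _ ∘ M₁ T.ε (M₁ t (ηᴾ _)) ∘ ηᴹ _
      ≈⟨ ∘-congˡ (extendʳ (natural (M.mult T.ε t) (ηᴾ _))) ⟩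
    M₁ εt μ ∘ M₁ εt (ηᴾ _) ∘ μᴹ T.ε t _ ∘ ηᴹ _
      ≈⟨ pullˡ (F-triangle (M.functor εt) Equiv.refl) ⟩
    M₁ εt (μ ∘ ηᴾ _) ∘ μᴹ T.ε t _ ∘ ηᴹ _ ∎
    where
      open HomReasoning
      εt = T.ε T.∙ t
      μ = μᴾ U.ε u X

  -- The three crossings needed to sort the word: `P₀ u` past `M₀ s`, then `P₀ v` and `P₀ u` past
  -- `M₀ t`. Doing the first and second in the other order gives the same map by naturality; fixing
  -- one order gives both sides of associativity a literally equal factor.
  distAll : ∀ r s t u v w X →
    M₀ r (P₀ u (M₀ s (P₀ v (M₀ t (P₀ w X))))) ⇒ M₀ r (M₀ s (M₀ t (P₀ u (P₀ v (P₀ w X)))))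
  distAll r s t u v w X =
    M₁ r (M₁ s (δ u t (P₀ v (P₀ w X)) ∘ P₁ u (δ v t (P₀ w X))) ∘ δ u s (P₀ v (M₀ t (P₀ w X))))

  -- The outer `δ` has to cross the inner product `s T.∙ t`, and `dist-multᴹ` splits it into a
  -- crossing of each factor. The inner `μᴾ` passes `δ` and then the outer `μᴹ` by naturality.
  mult-multʳ-normal : ∀ r s t u v w X →
    mult (r , u) ((s , v) TU.∙ (t , w)) X ∘ M₁ r (P₁ u (mult (s , v) (t , w) X))
      ≈ M₁ (r T.∙ (s T.∙ t)) (μᴾ u (v U.∙ w) X ∘ P₁ u (μᴾ v w X))
          ∘ (μᴹ r (s T.∙ t) _ ∘ M₁ r (μᴹ s t _)) ∘ distAll r s t u v w X
  mult-multʳ-normal r s t u v w X = begin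
    ((M₁ rst μ ∘ μᴹ r st _) ∘ M₁ r (δ u st _)) ∘ M₁ r (P₁ u (mult (s , v) (t , w) X))
      ≈⟨ Equiv.trans assoc assoc ⟩
    M₁ rst μ ∘ μᴹ r st _ ∘ M₁ r (δ u st _) ∘ M₁ r (P₁ u (mult (s , v) (t , w) X))
      ≈⟨ ∘-congˡ (∘-congˡ (F-square (M.functor r) dist-mult)) ⟩
    M₁ rst μ ∘ μᴹ r st _ ∘ M₁ r (M₁ st (P₁ u ν)) ∘ M₁ r (μᴹ s t _ ∘ d)
      ≈⟨ ∘-congˡ (extendʳ (natural (M.mult r st) (P₁ u ν))) ⟩
    M₁ rst μ ∘ M₁ rst (P₁ u ν) ∘ μᴹ r st _ ∘ M₁ r (μᴹ s t _ ∘ d)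
      ≈⟨ pullˡ (F-triangle (M.functor rst) Equiv.refl) ⟩
    M₁ rst (μ ∘ P₁ u ν) ∘ μᴹ r st _ ∘ M₁ r (μᴹ s t _ ∘ d)
      ≈⟨ ∘-congˡ (Equiv.trans (∘-congˡ (homomorphism (M.functor r))) (Equiv.sym assoc)) ⟩
    M₁ rst (μ ∘ P₁ u ν) ∘ (μᴹ r st _ ∘ M₁ r (μᴹ s t _)) ∘ M₁ r d ∎
    where
      open HomReasoning
      st = s T.∙ t
      rst = r T.∙ st
      μ = μᴾ u (v U.∙ w) X
      ν = μᴾ v w X
      d = M₁ s (δ u t (P₀ v (P₀ w X)) ∘ P₁ u (δ v t (P₀ w X))) ∘ δ u s (P₀ v (M₀ t (P₀ w X)))

      dist-mult : δ u st _ ∘ P₁ u (mult (s , v) (t , w) X) ≈ M₁ st (P₁ u ν) ∘ μᴹ s t _ ∘ d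
      dist-mult = begin
        δ u st _ ∘ P₁ u ((M₁ st ν ∘ μᴹ s t _) ∘ M₁ s (δ v t _))
          ≈⟨ ∘-congˡ (F-resp-≈ (P.functor u) assoc) ⟩
        δ u st _ ∘ P₁ u (M₁ st ν ∘ μᴹ s t _ ∘ M₁ s (δ v t _))
          ≈⟨ ∘-congˡ (Equiv.trans (homomorphism (P.functor u)) (∘-congˡ (homomorphism (P.functor u)))) ⟩
        δ u st _ ∘ P₁ u (M₁ st ν) ∘ P₁ u (μᴹ s t _) ∘ P₁ u (M₁ s (δ v t _))
          ≈⟨ extendʳ (natural (dist u st) ν) ⟩
        M₁ st (P₁ u ν) ∘ δ u st _ ∘ P₁ u (μᴹ s t _) ∘ P₁ u (M₁ s (δ v t _))
          ≈⟨ ∘-congˡ (extendʳ (dist-multᴹ u s t _)) ⟩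
        M₁ st (P₁ u ν) ∘ μᴹ s t _ ∘ (M₁ s (δ u t _) ∘ δ u s _) ∘ P₁ u (M₁ s (δ v t _))
          -- The inner multiplication has performed `δ v t` before `δ u s`; naturality of `dist u s`
          -- exchanges them into the order fixed by `distAll`.
          ≈⟨ ∘-congˡ (∘-congˡ (Equiv.trans assoc (∘-congˡ (natural (dist u s) (δ v t _))))) ⟩
        M₁ st (P₁ u ν) ∘ μᴹ s t _ ∘ M₁ s (δ u t _) ∘ M₁ s (P₁ u (δ v t _)) ∘ δ u s _
          ≈⟨ ∘-congˡ (∘-congˡ (pullˡ (F-triangle (M.functor s) Equiv.refl))) ⟩
        M₁ st (P₁ u ν) ∘ μᴹ s t _ ∘ d ∎

  -- Dually, the outer `δ` moves the product `u U.∙ v` past `M₀ t`, and `dist-multᴾ` splits it into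
  -- two successive crossings, releasing `μᴾ u v` on the left.
  mult-multˡ-normal : ∀ r s t u v w X →
    mult ((r , u) TU.∙ (s , v)) (t , w) X ∘ mult (r , u) (s , v) (M₀ t (P₀ w X))
      ≈ M₁ ((r T.∙ s) T.∙ t) (μᴾ (u U.∙ v) w X ∘ μᴾ u v (P₀ w X))
          ∘ (μᴹ (r T.∙ s) t _ ∘ μᴹ r s _) ∘ distAll r s t u v w X
  mult-multˡ-normal r s t u v w X = begin
    ((M₁ rst μ ∘ μᴹ rs t _) ∘ M₁ rs (δ uv t _)) ∘ (M₁ rs (μᴾ u v _) ∘ μᴹ r s _) ∘ M₁ r (δ u s _)
      ≈⟨ Equiv.trans assoc (Equiv.trans assoc (∘-congˡ (∘-congˡ (∘-congˡ assoc)))) ⟩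
    M₁ rst μ ∘ μᴹ rs t _ ∘ M₁ rs (δ uv t _) ∘ M₁ rs (μᴾ u v _) ∘ μᴹ r s _ ∘ M₁ r (δ u s _)
      ≈⟨ ∘-congˡ (∘-congˡ (extendʳ (F-square (M.functor rs) (dist-multᴾ u v t _)))) ⟩
    M₁ rst μ ∘ μᴹ rs t _ ∘ M₁ rs (M₁ t ν) ∘ M₁ rs c ∘ μᴹ r s _ ∘ M₁ r (δ u s _)
      ≈⟨ ∘-congˡ (extendʳ (natural (M.mult rs t) ν)) ⟩
    M₁ rst μ ∘ M₁ rst ν ∘ μᴹ rs t _ ∘ M₁ rs c ∘ μᴹ r s _ ∘ M₁ r (δ u s _)
      ≈⟨ pullˡ (F-triangle (M.functor rst) Equiv.refl) ⟩
    M₁ rst (μ ∘ ν) ∘ μᴹ rs t _ ∘ M₁ rs c ∘ μᴹ r s _ ∘ M₁ r (δ u s _)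
      -- Naturality of `μᴹ r s` is used from right to left, so that every crossing happens before
      -- any multiplication of `M`.
      ≈⟨ ∘-congˡ (∘-congˡ (extendʳ (Equiv.sym (natural (M.mult r s) c)))) ⟩
    M₁ rst (μ ∘ ν) ∘ μᴹ rs t _ ∘ μᴹ r s _ ∘ M₁ r (M₁ s c) ∘ M₁ r (δ u s _)
      ≈⟨ ∘-congˡ (∘-congˡ (∘-congˡ (F-triangle (M.functor r) Equiv.refl))) ⟩
    M₁ rst (μ ∘ ν) ∘ μᴹ rs t _ ∘ μᴹ r s _ ∘ M₁ r (M₁ s c ∘ δ u s _)
      ≈⟨ ∘-congˡ assoc ⟨
    M₁ rst (μ ∘ ν) ∘ (μᴹ rs t _ ∘ μᴹ r s _) ∘ M₁ r (M₁ s c ∘ δ u s _) ∎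
    where
      open HomReasoning
      rs = r T.∙ s
      rst = rs T.∙ t
      uv = u U.∙ v
      μ = μᴾ uv w X
      ν = μᴾ u v (P₀ w X)
      c = δ u t (P₀ v (P₀ w X)) ∘ P₁ u (δ v t (P₀ w X))

  isGradedMonad : IsGradedMonad (T ×ᴹ U) (compositeFunctor law) (compositeUnit law) (compositeMult law)
  isGradedMonad = record
    { mult-assoc = λ { (r , u) (s , v) (t , w) X → associative r s t u v w X }
    ; mult-unitʳ = λ { (t , u) X → regrade-composite-id (T.identityʳ t) (U.identityʳ u)
        (mult-unitʳ-normal t u X) (M.mult-unitʳ t (P₀ u X)) (P.mult-unitʳ u X) }
    ; mult-unitˡ = λ { (t , u) X → regrade-composite-id (T.identityˡ t) (U.identityˡ u)
        (mult-unitˡ-normal t u X) (M.mult-unitˡ t (P₀ u X)) (P.mult-unitˡ u X) }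
    }
    where
      open HomReasoning

      associative : ∀ r s t u v w X →
        mult (r , u) ((s , v) TU.∙ (t , w)) X ∘ M₁ r (P₁ u (mult (s , v) (t , w) X))
          ≈ regrade (T ×ᴹ U) (compositeFunctor law) (TU.assoc (r , u) (s , v) (t , w))
              (mult ((r , u) TU.∙ (s , v)) (t , w) X ∘ mult (r , u) (s , v) (M₀ t (P₀ w X)))
      associative r s t u v w X = begin
        mult (r , u) ((s , v) TU.∙ (t , w)) X ∘ M₁ r (P₁ u (mult (s , v) (t , w) X))
          ≈⟨ mult-multʳ-normal r s t u v w X ⟩
        M₁ (r T.∙ (s T.∙ t)) (μᴾ u (v U.∙ w) X ∘ P₁ u (μᴾ v w X))
          ∘ (μᴹ r (s T.∙ t) _ ∘ M₁ r (μᴹ s t _)) ∘ distAll r s t u v w X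
          -- The two associativity laws act on separate factors, that of `P` under the functor of
          -- `M`, while `distAll` stays untouched.
          ≈⟨ ∘-cong (F-resp-≈ (M.functor _) (P.mult-assoc u v w X)) (∘-congʳ (M.mult-assoc r s t _)) ⟩
        M₁ (r T.∙ (s T.∙ t)) (regrade U P.functor q (μᴾ (u U.∙ v) w X ∘ μᴾ u v (P₀ w X)))
          ∘ regrade T M.functor p (μᴹ (r T.∙ s) t _ ∘ μᴹ r s _) ∘ distAll r s t u v w X
          -- Extending the regrading over `distAll` gives the shape that `regrade-composite`
          -- expects, with everything after the `P` part as one morphism.
          ≈⟨ ∘-congˡ (regrade-∘ T M.functor p) ⟨
        M₁ (r T.∙ (s T.∙ t)) (regrade U P.functor q (μᴾ (u U.∙ v) w X ∘ μᴾ u v (P₀ w X)))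
          ∘ regrade T M.functor p ((μᴹ (r T.∙ s) t _ ∘ μᴹ r s _) ∘ distAll r s t u v w X)
          ≈⟨ regrade-composite p q ⟨
        regrade (T ×ᴹ U) (compositeFunctor law) (cong₂ _,_ p q)
          (M₁ ((r T.∙ s) T.∙ t) (μᴾ (u U.∙ v) w X ∘ μᴾ u v (P₀ w X))
            ∘ (μᴹ (r T.∙ s) t _ ∘ μᴹ r s _) ∘ distAll r s t u v w X)
          ≈⟨ regrade-composite-cong (cong₂ _,_ p q) (mult-multˡ-normal r s t u v w X) ⟨
        regrade (T ×ᴹ U) (compositeFunctor law) (cong₂ _,_ p q)
          (mult ((r , u) TU.∙ (s , v)) (t , w) X ∘ mult (r , u) (s , v) (M₀ t (P₀ w X))) ∎
        where
          p = T.assoc r s t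
          q = U.assoc u v w

theorem3p5 : {o ℓ e a b : Level}
    (C : Category o ℓ e) (T : GradingMonoid a) (U : GradingMonoid b)
    (M : GradedMonad C T) (P : GradedMonad C U)
    (law : GradedDistributiveLaw P M) →
    IsGradedMonad (T ×ᴹ U) (compositeFunctor law) (compositeUnit law) (compositeMult law)
theorem3p5 C T U M P law = Composite.isGradedMonad law
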